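{- $T_{\mathcal{ALBO}^{\mathsf{id}}}$ is a sound tableau calculus for satisfiability in $\mathcal{ALBO}^{\mathsf{id}}$; that is, for any (possibly infinite) set of concepts $\mathcal S$, each tableau $T_{\mathcal{ALBO}^{\mathsf{id}}}(\mathcal S)$ is open whenever $\mathcal S$ is satisfiable.
   Context: Language and semantics. Fix three disjoint alphabets: individuals ($a,a',\dots$), concept symbols ($A$), and role symbols ($Q$); $\mathsf{id}$ is a special role constant. Concepts $C,D$ and roles $R,S$ of $\mathcal{ALBO}^{\mathsf{id}}$: $C,D ::= A\mid\{a\}\mid\neg C\mid C\sqcup D\mid\exists R.C$ and $R,S ::= Q\mid R\sqcup S\mid R^{ -1}\mid\neg R\mid\mathsf{id}$. A model $\mathcal{I}$ consists of a non-empty set $\Delta^{\mathcal I}$, subsets $A^{\mathcal I}\subseteq\Delta^{\mathcal I}$, elements $a^{\mathcal I}\in\Delta^{\mathcal I}$, and relations $Q^{\mathcal I}\subseteq\Delta^{\mathcal I}\times\Delta^{\mathcal I}$, extended by $\{a\}^{\mathcal I}=\{a^{\mathcal I}\}$, $(\neg C)^{\mathcal I}=\Delta^{\mathcal I}\setminus C^{\mathcal I}$, $(C\sqcup D)^{\mathcal I}=C^{\mathcal I}\cup D^{\mathcal I}$, $(\exists R.C)^{\mathcal I}=\{x\mid\exists y\in C^{\mathcal I}\ (x,y)\in R^{\mathcal I}\}$, $(R\sqcup S)^{\mathcal I}=R^{\mathcal I}\cup S^{\mathcal I}$, $(R^{ -1})^{\mathcal I}=\{(x,y)\mid(y,x)\in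 R^{\mathcal I}\}$, $(\neg R)^{\mathcal I}=(\Delta^{\mathcal I}\times\Delta^{\mathcal I})\setminus R^{\mathcal I}$, $\mathsf{id}^{\mathcal I}=\{(x,x)\mid x\in\Delta^{\mathcal I}\}$. A concept is satisfiable iff $C^{\mathcal I}\ne\emptyset$ for some model $\mathcal I$; a set $\mathcal S$ of concepts is satisfiable iff for some model $\mathcal I$ some element of $\Delta^{\mathcal I}$ belongs to $C^{\mathcal I}$ for all $C\in\mathcal S$. A labelled concept $a:C$ is true in $\mathcal I$ iff $a^{\mathcal I}\in C^{\mathcal I}$. The calculus $T_{\mathcal{ALBO}^{\mathsf{id}}}$. Rules are written $X_0/X_1\mid\dots\mid X_n$ (premises / alternative sets of conclusions): $(\bot)$: $a:C,\ a:\neg C\,/\,\bot$ (the closure rule); $(\neg\neg)$: $a:\neg\neg C\,/\,a:C$; $(\neg\sqcup)$: $a:\neg(C\sqcup D)\,/\,a:\neg C,\ a:\neg D$; $(\sqcup)$: $a:C\sqcup D\,/\,a:C\mid a:D$; $(\exists)$: $a:\exists R.C\,/\,a:\exists R.\{a'\},\ a':C$, where $a'$ is new and uniquely associated with the premise, and the rule is applied only if $C$ is not a singleton $\{a''\}$; $(\neg\exists)$: $a:\neg\exists R.C,\ a:\exists R.\{a'\}\,/\,a':\neg C$; (sym): $a:\{a'\}\,/\,a':\{a\}$; ($\neg$sym): $a:\neg\{a'\}\,/\,a':\neg\{a\}$; (mon): $a:\{a'\},\ a':C\,/\,a:C$; (refl): $a:C\,/\,a:\{a\}$; $(\exists\sqcup)$: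 $a:\exists(R\sqcup S).\{a'\}\,/\,a:\exists R.\{a'\}\mid a:\exists S.\{a'\}$; $(\neg\exists\sqcup)$: $a:\neg\exists(R\sqcup S).C\,/\,a:\neg\exists R.C,\ a:\neg\exists S.C$; $(\exists^{ -1})$: $a:\exists R^{ -1}.\{a'\}\,/\,a':\exists R.\{a\}$; $(\neg\exists^{ -1})$: $a:\neg\exists R^{ -1}.C,\ a':\exists R.\{a\}\,/\,a':\neg C$; $(\exists\neg)$: $a:\exists\neg R.\{a'\}\,/\,a:\neg\exists R.\{a'\}$; $(\neg\exists\neg)$: $a:\neg\exists\neg R.C,\ a':\{a'\}\,/\,a:\exists R.\{a'\}\mid a':\neg C$; $(\exists\mathsf{id})$: $a:\exists\mathsf{id}.\{a'\}\,/\,a:\{a'\}$; $(\neg\exists\mathsf{id})$: $a:\neg\exists\mathsf{id}.C\,/\,a:\neg C$. Tableaux. Input concepts are first preprocessed by exhaustively rewriting, left to right, $(R\sqcup S)^{ -1}=R^{ -1}\sqcup S^{ -1}$, $(\neg R)^{ -1}=\neg(R^{ -1})$, $(R^{ -1})^{ -1}=R$, $\mathsf{id}^{ -1}=\mathsf{id}$. A tableau is a finitely branching ordered tree whose nodes are sets of labelled concepts; the root is $\{a:C\mid C\in\mathcal S\}$ for a fresh individual $a$; applying a rule $X_0/X_1\mid\dots\mid X_n$ to instances of its premises in a node creates $n$ successors, the $i$-th being the current node plus the instance of $X_i$. A rule is applied at most once to the same set of premises. $T(\mathcal S)$ denotes a tableau for calculus $T$ and input $\mathcal S$ that is fully expanded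 (all applicable rules have been applied on all branches, except that expansion of a branch may stop once the closure rule has been applied). A branch is a maximal path from the root. A branch is closed if a closure rule has been applied in it, and open otherwise; a tableau is closed if all its branches are closed, and open otherwise. -}

module Defs where

open import Level using (0ℓ)
open import Data.Nat using (ℕ; zero; suc; _<_)
open import Data.List using (List; []; _∷_; _++_; length)
open import Data.List.Membership.Propositional using () renaming (_∈_ to _∈ₗ_)
open import Data.List.Relation.Unary.All using (All)
open import Data.List.Relation.Binary.BagAndSetEquality using (_∼[_]_; set)
open import Data.Maybe using (Maybe; just; nothing; maybe′)
open import Data.Product using (Σ; _×_; _,_; ∃; ∃-syntax; ∃!)
open import Data.Sum using (_⊎_)
open import Data.Unit using (⊤)
open import Data.Empty using (⊥)
open import Function.Bundles using (_⇔_)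
open import Relation.Nullary using (¬_)
open import Relation.Unary using (Pred; _∈_; _∉_; _∪_; ∁; ｛_｝)
open import Relation.Binary.Core using (Rel)
open import Relation.Binary.PropositionalEquality using (_≡_)
open import Relation.Binary.Construct.Closure.ReflexiveTransitive using (Star)
open import Relation.Binary.Rewriting using (IsNormalForm)

-- Vertices of an ordered tree: [] is the root and i ∷ p is the i-th child
-- (counting from 0) of p, so the most recent turn comes first.
Address : Set
Address = List ℕ

-- The i-th list, or [] when i is out of range.
nth : {A : Set} → List (List A) → ℕ → List A
nth []       _       = []
nth (X ∷ _)  zero    = X
nth (_ ∷ Xs) (suc i) = nth Xs i

-- The parameters are the alphabets of individuals, concept symbols and role
-- symbols.
module ALBOid (Ind CSym RSym : Set) where

  infix  10 _⁻¹
  infix  9 ¬ʳ_ ¬ᶜ_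
  infixr 8 ∃ᶜ_∙_
  infixr 7 _⊔ʳ_ _⊔ᶜ_
  infix  6 _∶_
  infix  4 _⟶ʳ_ _⟶ᶜ_

  data Role : Set where
    sym  : RSym → Role
    _⊔ʳ_ : Role → Role → Role
    _⁻¹  : Role → Role
    ¬ʳ_  : Role → Role
    idʳ  : Role

  data Concept : Set where
    sym   : CSym → Concept
    ⁅_⁆   : Ind → Concept
    ¬ᶜ_   : Concept → Concept
    _⊔ᶜ_  : Concept → Concept → Concept
    ∃ᶜ_∙_ : Role → Concept → Concept

  record Model : Set₁ where
    field
      Δ         : Set
      inhabited : Δ
      concept   : CSym → Pred Δ 0ℓ
      indiv     : Ind → Δ
      role      : RSym → Rel Δ 0ℓ

    ⟦_⟧ʳ : Role → Rel Δ 0ℓ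
    ⟦ sym Q ⟧ʳ  x y = role Q x y
    ⟦ R ⊔ʳ S ⟧ʳ x y = ⟦ R ⟧ʳ x y ⊎ ⟦ S ⟧ʳ x y
    ⟦ R ⁻¹ ⟧ʳ   x y = ⟦ R ⟧ʳ y x
    ⟦ ¬ʳ R ⟧ʳ   x y = ¬ ⟦ R ⟧ʳ x y
    ⟦ idʳ ⟧ʳ    x y = x ≡ y

    ⟦_⟧ᶜ : Concept → Pred Δ 0ℓ
    ⟦ sym A ⟧ᶜ    = concept A
    ⟦ ⁅ a ⁆ ⟧ᶜ    = ｛ indiv a ｝
    ⟦ ¬ᶜ C ⟧ᶜ     = ∁ ⟦ C ⟧ᶜ
    ⟦ C ⊔ᶜ D ⟧ᶜ   = ⟦ C ⟧ᶜ ∪ ⟦ D ⟧ᶜ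
    ⟦ ∃ᶜ R ∙ C ⟧ᶜ = λ x → ∃[ y ] y ∈ ⟦ C ⟧ᶜ × ⟦ R ⟧ʳ x y

  Satisfiable : Pred Concept 0ℓ → Set₁
  Satisfiable 𝒮 =
    Σ Model λ I → let open Model I in
    ∃[ x ] (∀ {C} → C ∈ 𝒮 → x ∈ ⟦ C ⟧ᶜ)

  data _⟶ʳ_ : Rel Role 0ℓ where
    ⊔⁻¹  : ∀ {R S} → (R ⊔ʳ S) ⁻¹ ⟶ʳ (R ⁻¹) ⊔ʳ (S ⁻¹)
    ¬⁻¹  : ∀ {R} → (¬ʳ R) ⁻¹ ⟶ʳ ¬ʳ (R ⁻¹)
    ⁻¹⁻¹ : ∀ {R} → (R ⁻¹) ⁻¹ ⟶ʳ R
    id⁻¹ : idʳ ⁻¹ ⟶ʳ idʳ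
    in-⊔ˡ : ∀ {R R′ S} → R ⟶ʳ R′ → R ⊔ʳ S ⟶ʳ R′ ⊔ʳ S
    in-⊔ʳ : ∀ {R S S′} → S ⟶ʳ S′ → R ⊔ʳ S ⟶ʳ R ⊔ʳ S′
    in-⁻¹ : ∀ {R R′} → R ⟶ʳ R′ → R ⁻¹ ⟶ʳ R′ ⁻¹
    in-¬  : ∀ {R R′} → R ⟶ʳ R′ → ¬ʳ R ⟶ʳ ¬ʳ R′

  data _⟶ᶜ_ : Rel Concept 0ℓ where
    in-¬  : ∀ {C C′} → C ⟶ᶜ C′ → ¬ᶜ C ⟶ᶜ ¬ᶜ C′
    in-⊔ˡ : ∀ {C C′ D} → C ⟶ᶜ C′ → C ⊔ᶜ D ⟶ᶜ C′ ⊔ᶜ D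
    in-⊔ʳ : ∀ {C D D′} → D ⟶ᶜ D′ → C ⊔ᶜ D ⟶ᶜ C ⊔ᶜ D′
    in-∃ˡ : ∀ {R R′ C} → R ⟶ʳ R′ → ∃ᶜ R ∙ C ⟶ᶜ ∃ᶜ R′ ∙ C
    in-∃ʳ : ∀ {R C C′} → C ⟶ᶜ C′ → ∃ᶜ R ∙ C ⟶ᶜ ∃ᶜ R ∙ C′

  PreprocessesTo : Rel Concept 0ℓ
  PreprocessesTo C C′ = Star _⟶ᶜ_ C C′ × IsNormalForm _⟶ᶜ_ C′

  data Formula : Set where
    _∶_ : Ind → Concept → Formula
    ⊥ᶠ  : Formula

  data Rule : Set where
    clash ¬¬ ¬⊔ ⊔ ex ¬ex symm ¬symm mon rfl : Rule
    ex⊔ ¬ex⊔ ex⁻¹ ¬ex⁻¹ ex¬ ¬ex¬ exid ¬exid : Rule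

  IsSingleton : Pred Concept 0ℓ
  IsSingleton C = ∃[ a ] C ≡ ⁅ a ⁆

  -- Instance ρ X₀ (X₁ ∷ … ∷ Xₙ ∷ []) says that X₀ / X₁ ∣ … ∣ Xₙ is an instance
  -- of ρ.  The newness of the individual b in ∃ is not part of an instance: it
  -- is imposed where an instance is applied (see Tableau).
  data Instance : Rule → List Formula → List (List Formula) → Set where
    ⊥-rule : ∀ {a C} → Instance clash
      (a ∶ C ∷ a ∶ ¬ᶜ C ∷ [])
      ((⊥ᶠ ∷ []) ∷ [])
    ¬¬-rule : ∀ {a C} → Instance ¬¬
      (a ∶ ¬ᶜ ¬ᶜ C ∷ [])
      ((a ∶ C ∷ []) ∷ [])
    ¬⊔-rule : ∀ {a C D} → Instance ¬⊔
      (a ∶ ¬ᶜ (C ⊔ᶜ D) ∷ [])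
      ((a ∶ ¬ᶜ C ∷ a ∶ ¬ᶜ D ∷ []) ∷ [])
    ⊔-rule : ∀ {a C D} → Instance ⊔
      (a ∶ C ⊔ᶜ D ∷ [])
      ((a ∶ C ∷ []) ∷ (a ∶ D ∷ []) ∷ [])
    ∃-rule : ∀ {a b R C} → ¬ IsSingleton C → Instance ex
      (a ∶ ∃ᶜ R ∙ C ∷ [])
      ((a ∶ ∃ᶜ R ∙ ⁅ b ⁆ ∷ b ∶ C ∷ []) ∷ [])
    ¬∃-rule : ∀ {a b R C} → Instance ¬ex
      (a ∶ ¬ᶜ (∃ᶜ R ∙ C) ∷ a ∶ ∃ᶜ R ∙ ⁅ b ⁆ ∷ [])
      ((b ∶ ¬ᶜ C ∷ []) ∷ [])
    sym-rule : ∀ {a b} → Instance symm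
      (a ∶ ⁅ b ⁆ ∷ [])
      ((b ∶ ⁅ a ⁆ ∷ []) ∷ [])
    ¬sym-rule : ∀ {a b} → Instance ¬symm
      (a ∶ ¬ᶜ ⁅ b ⁆ ∷ [])
      ((b ∶ ¬ᶜ ⁅ a ⁆ ∷ []) ∷ [])
    mon-rule : ∀ {a b C} → Instance mon
      (a ∶ ⁅ b ⁆ ∷ b ∶ C ∷ [])
      ((a ∶ C ∷ []) ∷ [])
    refl-rule : ∀ {a C} → Instance rfl
      (a ∶ C ∷ [])
      ((a ∶ ⁅ a ⁆ ∷ []) ∷ [])
    ∃⊔-rule : ∀ {a b R S} → Instance ex⊔
      (a ∶ ∃ᶜ (R ⊔ʳ S) ∙ ⁅ b ⁆ ∷ [])
      ((a ∶ ∃ᶜ R ∙ ⁅ b ⁆ ∷ []) ∷ (a ∶ ∃ᶜ S ∙ ⁅ b ⁆ ∷ []) ∷ [])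
    ¬∃⊔-rule : ∀ {a R S C} → Instance ¬ex⊔
      (a ∶ ¬ᶜ (∃ᶜ (R ⊔ʳ S) ∙ C) ∷ [])
      ((a ∶ ¬ᶜ (∃ᶜ R ∙ C) ∷ a ∶ ¬ᶜ (∃ᶜ S ∙ C) ∷ []) ∷ [])
    ∃⁻¹-rule : ∀ {a b R} → Instance ex⁻¹
      (a ∶ ∃ᶜ (R ⁻¹) ∙ ⁅ b ⁆ ∷ [])
      ((b ∶ ∃ᶜ R ∙ ⁅ a ⁆ ∷ []) ∷ [])
    ¬∃⁻¹-rule : ∀ {a b R C} → Instance ¬ex⁻¹
      (a ∶ ¬ᶜ (∃ᶜ (R ⁻¹) ∙ C) ∷ b ∶ ∃ᶜ R ∙ ⁅ a ⁆ ∷ [])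
      ((b ∶ ¬ᶜ C ∷ []) ∷ [])
    ∃¬-rule : ∀ {a b R} → Instance ex¬
      (a ∶ ∃ᶜ (¬ʳ R) ∙ ⁅ b ⁆ ∷ [])
      ((a ∶ ¬ᶜ (∃ᶜ R ∙ ⁅ b ⁆) ∷ []) ∷ [])
    ¬∃¬-rule : ∀ {a b R C} → Instance ¬ex¬
      (a ∶ ¬ᶜ (∃ᶜ (¬ʳ R) ∙ C) ∷ b ∶ ⁅ b ⁆ ∷ [])
      ((a ∶ ∃ᶜ R ∙ ⁅ b ⁆ ∷ []) ∷ (b ∶ ¬ᶜ C ∷ []) ∷ [])
    ∃id-rule : ∀ {a b} → Instance exid
      (a ∶ ∃ᶜ idʳ ∙ ⁅ b ⁆ ∷ [])
      ((a ∶ ⁅ b ⁆ ∷ []) ∷ [])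
    ¬∃id-rule : ∀ {a C} → Instance ¬exid
      (a ∶ ¬ᶜ (∃ᶜ idʳ ∙ C) ∷ [])
      ((a ∶ ¬ᶜ C ∷ []) ∷ [])

  record Inference : Set where
    constructor infer
    field
      {rule}        : Rule
      {premises}    : List Formula
      {conclusions} : List (List Formula)
      valid         : Instance rule premises conclusions
  open Inference public

  newIndividual : Inference → Maybe Ind
  newIndividual (infer (∃-rule {b = b} _)) = just b
  newIndividual _                          = nothing

  -- Premises are compared as sets, so their order and repetitions are
  -- irrelevant.
  SameApplication : Rel Inference 0ℓ
  SameApplication ι κ = rule ι ≡ rule κ × (premises ι ∼[ set ] premises κ)

  _occursIn_ : Ind → Concept → Set
  a occursIn sym A      = ⊥
  a occursIn ⁅ b ⁆      = a ≡ b
  a occursIn (¬ᶜ C)     = a occursIn C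
  a occursIn (C ⊔ᶜ D)   = a occursIn C ⊎ a occursIn D
  a occursIn (∃ᶜ R ∙ C) = a occursIn C

  _occursInᶠ_ : Ind → Formula → Set
  a occursInᶠ (b ∶ C) = a ≡ b ⊎ a occursIn C
  a occursInᶠ ⊥ᶠ      = ⊥

  -- A tree is presented by the individual at its root and the inference
  -- applied at each address, nothing marking a leaf.  Its vertices and their
  -- labels are determined by these; the values of step outside InTree are
  -- junk.
  record Tree : Set where
    field
      rootInd : Ind
      step    : Address → Maybe Inference

    alternatives : Address → List (List Formula)
    alternatives p = maybe′ conclusions [] (step p)

    InTree : Address → Set
    InTree []      = ⊤
    InTree (i ∷ p) = InTree p × i < length (alternatives p)

    label : Pred Concept 0ℓ → Address → Pred Formula 0ℓ
    label 𝒮 []      φ = ∃[ C ] C ∈ 𝒮 × (∃[ C′ ] PreprocessesTo C C′ × φ ≡ rootInd ∶ C′)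
    label 𝒮 (i ∷ p) φ = φ ∈ label 𝒮 p ⊎ φ ∈ₗ nth (alternatives p) i

  -- Tableaux with input 𝒮, not necessarily fully expanded.
  record Tableau (𝒮 : Pred Concept 0ℓ) : Set where
    field
      tree : Tree
    open Tree tree public hiding (label)

    label : Address → Pred Formula 0ℓ
    label = Tree.label tree 𝒮

    field
      root-fresh : ∀ {C} → C ∈ 𝒮 → ¬ rootInd occursIn C

      premises-present : ∀ {p ι} → InTree p → step p ≡ just ι →
        All (label p) (premises ι)

      new-fresh : ∀ {p ι a} → InTree p → step p ≡ just ι →
        newIndividual ι ≡ just a →
        ∀ {φ} → φ ∈ label p → ¬ a occursInᶠ φ

      -- Throughout the tableau, new individuals and premises of the
      -- ∃-rule determine each other.
      new-unique : ∀ {p q ι κ a b} →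
        InTree p → step p ≡ just ι → newIndividual ι ≡ just a →
        InTree q → step q ≡ just κ → newIndividual κ ≡ just b →
        a ≡ b ⇔ premises ι ≡ premises κ

      -- (k ∷ q) ++ p ranges over the proper descendants of p.
      applied-once : ∀ {p k q ι κ} →
        InTree ((k ∷ q) ++ p) → step p ≡ just ι → step ((k ∷ q) ++ p) ≡ just κ →
        ¬ SameApplication ι κ

  module _ {𝒮 : Pred Concept 0ℓ} (T : Tableau 𝒮) where
    open Tableau T

    -- A maximal path from the root, given by the set of its vertices.
    record Branch : Set₁ where
      field
        On        : Pred Address 0ℓ
        in-tree   : ∀ {p} → p ∈ On → InTree p
        root-on   : [] ∈ On
        parent-on : ∀ {i p} → (i ∷ p) ∈ On → p ∈ On
        child-on  : ∀ {p ι} → p ∈ On → step p ≡ just ι →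
                    ∃! _≡_ (λ i → (i ∷ p) ∈ On)
    open Branch

    Applied : Branch → Pred Inference 0ℓ
    Applied B ι = ∃[ p ] p ∈ On B × step p ≡ just ι

    ClosedBranch : Branch → Set
    ClosedBranch B = ∃[ ι ] ι ∈ Applied B × rule ι ≡ clash

    OpenBranch : Branch → Set
    OpenBranch B = ¬ ClosedBranch B

    Present : Branch → Pred Formula 0ℓ
    Present B φ = ∃[ p ] p ∈ On B × φ ∈ label p

    FullyExpanded : Set₁
    FullyExpanded = ∀ B → OpenBranch B → ∀ ι → All (Present B) (premises ι) →
      ∃[ κ ] κ ∈ Applied B × SameApplication ι κ

    Closed : Set₁
    Closed = ∀ B → ClosedBranch B

    Open : Set₁
    Open = ¬ Closed

{-# OPTIONS --safe #-}

-- For a fixed model, call a set of labelled concepts realizable if some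
-- valuation of the individuals makes all of them true.  The root is realizable
-- because its individual is fresh, and every inference passes realizability on
-- to one of its conclusions: a new individual can be revalued freely, since it
-- does not occur in the node.  Descending at every vertex to the least
-- realizable child yields a branch, and no closure rule applies in it, since
-- its premises are not realizable.

module Submission where

open import Level using (0ℓ)
open import Relation.Unary using (Pred)
open import Axiom.ExcludedMiddle using (ExcludedMiddle)
open import Defs
open import Data.Empty using (⊥; ⊥-elim)
open import Data.List using (List; []; _∷_; length)
open import Data.List.Membership.Propositional using () renaming (_∈_ to _∈ₗ_)
open import Data.List.Relation.Unary.All using (All; []; _∷_; lookup)
import Data.List.Relation.Unary.All as All
open import Data.List.Relation.Unary.Any using (Any; here; there)
open import Data.Maybe using (just)
open import Data.Nat using (ℕ; zero; suc; _<_; s≤s; z≤n)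
open import Data.Nat.Induction using (<-rec)
open import Data.Nat.Properties using (anyUpTo?; <-cmp)
open import Data.Product using (_×_; _,_; ∃; ∃!; ∃-syntax; proj₁; proj₂; map₂)
import Data.Product as Product
open import Data.Product.Function.Dependent.Propositional using () renaming (congˡ to ∃-cong)
open import Data.Product.Function.NonDependent.Propositional using (_×-⇔_)
open import Data.Sum using (inj₁; inj₂; [_,_])
import Data.Sum as Sum
open import Data.Sum.Function.Propositional using (_⊎-⇔_)
open import Data.Unit using (⊤)
open import Function using (_∘_; id)
open import Function.Bundles using (_⇔_; mk⇔; Equivalence)
open import Function.Properties.Equivalence using () renaming (refl to ⇔-refl)
open import Function.Related.TypeIsomorphisms using (¬-cong-⇔)
open import Relation.Binary.Construct.Closure.ReflexiveTransitive using (fold)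
open import Relation.Binary.Definitions using (tri<; tri≈; tri>)
open import Relation.Binary.PropositionalEquality as ≡ using (_≡_; _≢_; refl)
open import Relation.Nullary using (¬_; yes; no)
open import Relation.Nullary.Decidable using (decidable-stable)
open import Relation.Unary using (_∈_; _⊆_; Decidable)

open Equivalence using (to)

-- Least numbers and positions in lists.

Least : Pred ℕ 0ℓ → Pred ℕ 0ℓ
Least P n = P n × ∀ {m} → m < n → ¬ P m

Least-unique : ∀ {P m n} → Least P m → Least P n → m ≡ n
Least-unique {m = m} {n} (Pm , m-least) (Pn , n-least) with <-cmp m n
... | tri< m<n _ _ = ⊥-elim (n-least m<n Pm)
... | tri≈ _ m≡n _ = m≡n
... | tri> _ _ n<m = ⊥-elim (m-least n<m Pn)

∃-least : ∀ {P} → Decidable P → ∀ n → P n → ∃ (Least P)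
∃-least {P} P? = <-rec _ go
  where
  go : ∀ n → (∀ {m} → m < n → P m → ∃ (Least P)) → P n → ∃ (Least P)
  go n rec Pn with anyUpTo? P? n
  ... | yes (_ , m<n , Pm) = rec m<n Pm
  ... | no  ∄m             = n , Pn , λ m<n Pm → ∄m (_ , m<n , Pm)

-- Turns a conclusion known to be true into the number of a child. The bound keeps the default value
-- of `nth` out of play.
Any⇒nth : ∀ {A : Set} {P : Pred (List A) 0ℓ} {Xs} → Any P Xs →
  ∃[ i ] i < length Xs × P (nth Xs i)
Any⇒nth (here px)  = zero , s≤s z≤n , px
Any⇒nth (there ps) = Product.map suc (Product.map s≤s id) (Any⇒nth ps)

-- Truth under varying valuations of the individuals in a fixed model.

module Semantics (em : ExcludedMiddle 0ℓ) (Ind CSym RSym : Set)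
                 (I : ALBOid.Model Ind CSym RSym) where
  open ALBOid Ind CSym RSym
  open Model I using (Δ; indiv)

  infix 4 _⊨_
  infix 9 _[_↦_]

  Valuation : Set
  Valuation = Ind → Δ

  under : Valuation → Model
  under v = record
    { Δ         = Δ
    ; inhabited = Model.inhabited I
    ; concept   = Model.concept I
    ; indiv     = v
    ; role      = Model.role I
    }

  R⟦_⟧ : Role → Valuation → Δ → Δ → Set
  R⟦ R ⟧ v = Model.⟦_⟧ʳ (under v) R

  C⟦_⟧ : Concept → Valuation → Δ → Set
  C⟦ C ⟧ v = Model.⟦_⟧ᶜ (under v) C

  _⊨_ : Valuation → Pred Formula 0ℓ
  v ⊨ a ∶ C = C⟦ C ⟧ v (v a)
  v ⊨ ⊥ᶠ    = ⊥

  Realizable : Pred (Pred Formula 0ℓ) 0ℓ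
  Realizable X = ∃[ v ] X ⊆ (v ⊨_)

  -- No individual occurs in a role. Under `¬ʳ_` the induction hypothesis is used from `w` back to
  -- `v`.
  role-irrelevant : ∀ R {v w x y} → R⟦ R ⟧ v x y → R⟦ R ⟧ w x y
  role-irrelevant (sym Q)  = id
  role-irrelevant (R ⊔ʳ S) = Sum.map (role-irrelevant R) (role-irrelevant S)
  role-irrelevant (R ⁻¹)   = role-irrelevant R
  role-irrelevant (¬ʳ R)   = _∘ role-irrelevant R
  role-irrelevant idʳ      = id

  coincidenceᶜ : ∀ C {v w x} → (∀ {a} → a occursIn C → v a ≡ w a) →
    C⟦ C ⟧ v x → C⟦ C ⟧ w x
  coincidenceᶜ (sym A)   v≈w = id
  coincidenceᶜ ⁅ a ⁆     v≈w = ≡.trans (≡.sym (v≈w refl))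
  coincidenceᶜ (¬ᶜ C)    v≈w = _∘ coincidenceᶜ C (≡.sym ∘ v≈w)
  coincidenceᶜ (C ⊔ᶜ D)  v≈w =
    Sum.map (coincidenceᶜ C (v≈w ∘ inj₁)) (coincidenceᶜ D (v≈w ∘ inj₂))
  coincidenceᶜ (∃ᶜ R ∙ C) v≈w =
    map₂ (Product.map (coincidenceᶜ C v≈w) (role-irrelevant R))

  coincidence : ∀ φ {v w} → (∀ {a} → a occursInᶠ φ → v a ≡ w a) →
    v ⊨ φ → w ⊨ φ
  coincidence (a ∶ C) {v} {w} v≈w v⊨φ =
    ≡.subst (C⟦ C ⟧ w) (v≈w (inj₁ refl)) (coincidenceᶜ C (v≈w ∘ inj₂) v⊨φ)

  -- `Ind` is an arbitrary set, so equality of individuals is decided by excluded middle.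
  _[_↦_] : Valuation → Ind → Δ → Valuation
  (v [ a ↦ x ]) b with em {b ≡ a}
  ... | yes _ = x
  ... | no  _ = v b

  ↦-same : ∀ v a x → (v [ a ↦ x ]) a ≡ x
  ↦-same v a x with em {a ≡ a}
  ... | yes _   = refl
  ... | no  a≢a = ⊥-elim (a≢a refl)

  ↦-other : ∀ v {a x b} → b ≢ a → v b ≡ (v [ a ↦ x ]) b
  ↦-other v {a} {x} {b} b≢a with em {b ≡ a}
  ... | yes b≡a = ⊥-elim (b≢a b≡a)
  ... | no  _   = refl

  fresh-↦ᶜ : ∀ C {v a x y} → ¬ a occursIn C → C⟦ C ⟧ v y → C⟦ C ⟧ (v [ a ↦ x ]) y
  fresh-↦ᶜ C {v} a∉C =
    coincidenceᶜ C λ b∈C → ↦-other v λ b≡a → a∉C (≡.subst (_occursIn C) b≡a b∈C)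

  -- Soundness of preprocessing and of the rules.

  ⟶ʳ-sound : ∀ {R R′} → R ⟶ʳ R′ → ∀ v {x y} → R⟦ R ⟧ v x y ⇔ R⟦ R′ ⟧ v x y
  ⟶ʳ-sound ⊔⁻¹       v = ⇔-refl
  ⟶ʳ-sound ¬⁻¹       v = ⇔-refl
  ⟶ʳ-sound ⁻¹⁻¹      v = ⇔-refl
  ⟶ʳ-sound id⁻¹      v = mk⇔ ≡.sym ≡.sym
  ⟶ʳ-sound (in-⊔ˡ r) v = ⟶ʳ-sound r v ⊎-⇔ ⇔-refl
  ⟶ʳ-sound (in-⊔ʳ r) v = ⇔-refl ⊎-⇔ ⟶ʳ-sound r v
  ⟶ʳ-sound (in-⁻¹ r) v = ⟶ʳ-sound r v
  ⟶ʳ-sound (in-¬ r)  v = ¬-cong-⇔ (⟶ʳ-sound r v)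

  -- An equivalence, as for roles, because rewriting also happens under negations, which reverse
  -- implications.
  ⟶ᶜ-sound : ∀ {C C′} → C ⟶ᶜ C′ → ∀ v {x} → C⟦ C ⟧ v x ⇔ C⟦ C′ ⟧ v x
  ⟶ᶜ-sound (in-¬ r)  v = ¬-cong-⇔ (⟶ᶜ-sound r v)
  ⟶ᶜ-sound (in-⊔ˡ r) v = ⟶ᶜ-sound r v ⊎-⇔ ⇔-refl
  ⟶ᶜ-sound (in-⊔ʳ r) v = ⇔-refl ⊎-⇔ ⟶ᶜ-sound r v
  ⟶ᶜ-sound (in-∃ˡ r) v = ∃-cong (⇔-refl ×-⇔ ⟶ʳ-sound r v)
  ⟶ᶜ-sound (in-∃ʳ r) v = ∃-cong (⟶ᶜ-sound r v ×-⇔ ⇔-refl)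

  preprocessing-sound : ∀ {C C′} → PreprocessesTo C C′ → ∀ v {x} →
    C⟦ C ⟧ v x → C⟦ C′ ⟧ v x
  preprocessing-sound (C⟶*C′ , _) v {x} =
    fold (λ C D → C⟦ C ⟧ v x → C⟦ D ⟧ v x)
         (λ r f → f ∘ to (⟶ᶜ-sound r v)) id C⟶*C′

  -- Only the rule for existentials changes the valuation, and only at its new individual; elsewhere
  -- `w` is `v`, and truth in the model selects the alternative. The agreement of `v` and `w` lets
  -- the rest of the node be carried over later.
  inference-sound : ∀ ι {v} →
    (∀ {a} → newIndividual ι ≡ just a → All (λ φ → ¬ a occursInᶠ φ) (premises ι)) →
    All (v ⊨_) (premises ι) →
    ∃[ w ] (∀ {a} → newIndividual ι ≢ just a → v a ≡ w a) ×
           Any (All (w ⊨_)) (conclusions ι)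
  inference-sound (infer (∃-rule {a} {b} {R} {C} _)) {v} fresh ((y , Cy , Ray) ∷ [])
    with fresh refl
  ... | b∉ ∷ [] =
      -- The new individual `b` is sent to the witness `y` of the premise. Since `b` does not occur
      -- in the premise, neither the value of `a` nor the truth of `C` at `y` is affected.
      w
    , (λ b≢c → ↦-other v (λ c≡b → b≢c (≡.cong just (≡.sym c≡b))))
    , here ((y , wb≡y , ≡.subst (λ z → R⟦ R ⟧ w z y) va≡wa (role-irrelevant R Ray))
           ∷ ≡.subst (C⟦ C ⟧ w) (≡.sym wb≡y) (fresh-↦ᶜ C (b∉ ∘ inj₂) Cy) ∷ [])
    where
    w     = v [ b ↦ y ]
    wb≡y  = ↦-same v b y
    va≡wa : v a ≡ w a
    va≡wa = ↦-other v (b∉ ∘ inj₁ ∘ ≡.sym)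
  inference-sound (infer ⊥-rule) _ (Ca ∷ ¬Ca ∷ []) = ⊥-elim (¬Ca Ca)
  inference-sound (infer ¬¬-rule) {v} _ (¬¬Ca ∷ []) =
    v , (λ _ → refl) , here (decidable-stable em ¬¬Ca ∷ [])
  inference-sound (infer ¬⊔-rule) {v} _ (¬CD ∷ []) =
    v , (λ _ → refl) , here ((¬CD ∘ inj₁) ∷ (¬CD ∘ inj₂) ∷ [])
  inference-sound (infer ⊔-rule) {v} _ (inj₁ Ca ∷ []) =
    v , (λ _ → refl) , here (Ca ∷ [])
  inference-sound (infer ⊔-rule) {v} _ (inj₂ Da ∷ []) =
    v , (λ _ → refl) , there (here (Da ∷ []))
  -- Membership in a singleton is an equation, so matching on `refl` makes the successor the value
  -- of `b` itself.
  inference-sound (infer ¬∃-rule) {v} _ (∄y ∷ (_ , refl , Rab) ∷ []) =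
    v , (λ _ → refl) , here ((λ Cb → ∄y (_ , Cb , Rab)) ∷ [])
  inference-sound (infer sym-rule) {v} _ (b≡a ∷ []) =
    v , (λ _ → refl) , here (≡.sym b≡a ∷ [])
  inference-sound (infer ¬sym-rule) {v} _ (b≢a ∷ []) =
    v , (λ _ → refl) , here ((b≢a ∘ ≡.sym) ∷ [])
  inference-sound (infer (mon-rule {C = C})) {v} _ (b≡a ∷ Cb ∷ []) =
    v , (λ _ → refl) , here (≡.subst (C⟦ C ⟧ v) b≡a Cb ∷ [])
  inference-sound (infer refl-rule) {v} _ _ =
    v , (λ _ → refl) , here (refl ∷ [])
  inference-sound (infer ∃⊔-rule) {v} _ ((y , b≡y , inj₁ Ray) ∷ []) =
    v , (λ _ → refl) , here ((y , b≡y , Ray) ∷ [])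
  inference-sound (infer ∃⊔-rule) {v} _ ((y , b≡y , inj₂ Say) ∷ []) =
    v , (λ _ → refl) , there (here ((y , b≡y , Say) ∷ []))
  inference-sound (infer ¬∃⊔-rule) {v} _ (∄y ∷ []) =
      v , (λ _ → refl)
    , here ((∄y ∘ map₂ (map₂ inj₁)) ∷ (∄y ∘ map₂ (map₂ inj₂)) ∷ [])
  inference-sound (infer ∃⁻¹-rule) {v} _ ((_ , refl , Rba) ∷ []) =
    v , (λ _ → refl) , here ((_ , refl , Rba) ∷ [])
  inference-sound (infer ¬∃⁻¹-rule) {v} _ (∄y ∷ (_ , refl , Rba) ∷ []) =
    v , (λ _ → refl) , here ((λ Cb → ∄y (_ , Cb , Rba)) ∷ [])
  inference-sound (infer ∃¬-rule) {v} _ ((_ , refl , ¬Rab) ∷ []) =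
    v , (λ _ → refl) , here ((λ { (_ , refl , Rab) → ¬Rab Rab }) ∷ [])
  inference-sound (infer (¬∃¬-rule {a} {b} {R})) {v} _ (∄y ∷ _)
    -- The two cases are the two alternatives: without an `R`-edge, `b` is a successor under the
    -- negated role and so cannot satisfy `C`.
    with em {R⟦ R ⟧ v (v a) (v b)}
  ... | yes Rab = v , (λ _ → refl) , here ((_ , refl , Rab) ∷ [])
  ... | no ¬Rab = v , (λ _ → refl) , there (here ((λ Cb → ∄y (_ , Cb , ¬Rab)) ∷ []))
  inference-sound (infer ∃id-rule) {v} _ ((_ , b≡y , a≡y) ∷ []) =
    v , (λ _ → refl) , here (≡.trans b≡y (≡.sym a≡y) ∷ [])
  inference-sound (infer ¬∃id-rule) {v} _ (∄y ∷ []) =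
    v , (λ _ → refl) , here ((λ Ca → ∄y (_ , Ca , refl)) ∷ [])

  -- The branch of realizable vertices.

  module _ {𝒮 : Pred Concept 0ℓ} (T : Tableau 𝒮) where
    open Tableau T

    root-realizable : ∀ {x} → (∀ {C} → C ∈ 𝒮 → C⟦ C ⟧ indiv x) → Realizable (label [])
    root-realizable {x} x∈𝒮 = w , w⊨root
      where
      w = indiv [ rootInd ↦ x ]

      w⊨root : label [] ⊆ (w ⊨_)
      w⊨root (C , C∈𝒮 , _ , C⟶*C′ , refl) =
        -- Freshness is given for the input concept `C`, so the revaluation is justified there and
        -- truth is then passed to `C′`.
        preprocessing-sound C⟶*C′ w
          (≡.subst (C⟦ C ⟧ w) (≡.sym (↦-same indiv rootInd x))
            (fresh-↦ᶜ C (root-fresh C∈𝒮) (x∈𝒮 C∈𝒮)))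

    RealizableChild : Address → Pred ℕ 0ℓ
    RealizableChild p i = i < length (alternatives p) × Realizable (label (i ∷ p))

    ∃-realizable-child : ∀ {p ι} → InTree p → step p ≡ just ι →
      Realizable (label p) → ∃ (RealizableChild p)
    ∃-realizable-child {p} {ι} p∈T eq (v , v⊨p)
      with inference-sound ι
             (λ new → All.map (new-fresh p∈T eq new) (premises-present p∈T eq))
             (All.map v⊨p (premises-present p∈T eq))
    -- Abstracting `step p` together with `eq` lets `alternatives p` compute to the conclusions of
    -- `ι`.
    ... | w , v≈w , w⊨some with step p | eq | Any⇒nth w⊨some
    ... | _ | refl | i , i<n , w⊨i = i , i<n , w , [ w⊨p , lookup w⊨i ]
      where
      w⊨p : label p ⊆ (w ⊨_)
      -- A new individual is fresh for the whole node, so `v` and `w` agree on everything occurring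
      -- in `φ`.
      w⊨p {φ} φ∈p = coincidence φ
        (λ a∈φ → v≈w λ new → new-fresh p∈T eq new φ∈p a∈φ) (v⊨p φ∈p)

    -- Several children may be realizable; taking the least gives the uniqueness that `child-on`
    -- demands.
    OnBranch : Pred Address 0ℓ
    OnBranch []      = ⊤
    OnBranch (i ∷ p) = OnBranch p × Least (RealizableChild p) i

    OnBranch⇒InTree : ∀ p → OnBranch p → InTree p
    OnBranch⇒InTree []      _                       = _
    OnBranch⇒InTree (i ∷ p) (p∈B , (i<n , _) , _) = OnBranch⇒InTree p p∈B , i<n

    module _ (root : Realizable (label [])) where

      OnBranch⇒Realizable : ∀ p → OnBranch p → Realizable (label p)
      OnBranch⇒Realizable []      _                       = root
      OnBranch⇒Realizable (i ∷ p) (_ , (_ , i-real) , _) = i-real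

      branch : Branch T
      branch = record
        { On        = OnBranch
        ; in-tree   = λ {p} → OnBranch⇒InTree p
        ; root-on   = _
        ; parent-on = proj₁
        ; child-on  = child
        }
        where
        child : ∀ {p ι} → OnBranch p → step p ≡ just ι →
          ∃! _≡_ (λ i → OnBranch (i ∷ p))
        child {p} p∈B eq
          with ∃-realizable-child (OnBranch⇒InTree p p∈B) eq (OnBranch⇒Realizable p p∈B)
        -- Realizability is decided by excluded middle in the search for the least child.
        ... | j , j-real with ∃-least (λ _ → em) j j-real
        ... | i , i-least = i , (p∈B , i-least) , Least-unique i-least ∘ proj₂

      branch-open : OpenBranch T branch
      branch-open (infer ⊥-rule , (p , p∈B , eq) , refl)
        with OnBranch⇒Realizable p p∈B | premises-present (OnBranch⇒InTree p p∈B) eq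
      ... | v , v⊨p | Ca ∷ ¬Ca ∷ [] = v⊨p ¬Ca (v⊨p Ca)

theorem5p1 : ExcludedMiddle 0ℓ →
    (Ind CSym RSym : Set) →
    let open ALBOid Ind CSym RSym in
    (𝒮 : Pred Concept 0ℓ) (T : Tableau 𝒮) →
    FullyExpanded T → Satisfiable 𝒮 → Open T
theorem5p1 em Ind CSym RSym 𝒮 T _ (I , x , x∈𝒮) closed =
  branch-open T root (closed (branch T root))
  where
  open Semantics em Ind CSym RSym I
  root = root-realizable T x∈𝒮
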